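{- Let $r,t$ be integers with $1 \leq t\leq r-2$. Then there exist an $r$-regular graph $G$ that has a $t$-factor and a set $\mathcal{O}$ of pairwise edge-disjoint odd cycles of $G$ such that every $t$-factor of $G$ is edge-disjoint from at least one cycle of $\mathcal{O}$.
   Context: All graphs are finite and loopless but may have parallel edges. A cycle is a connected $2$-regular subgraph; it is odd if it has an odd number of edges. A $t$-factor of $G$ is a spanning $t$-regular subgraph. -}

module Defs where

open import Data.Bool using (_∨_)
open import Data.Fin using (Fin)
open import Data.Fin.Properties using (_≟_)
open import Data.Fin.Subset using (Subset; _∈_; _∩_; ⊤; ∣_∣; Empty; Nonempty)
open import Data.Fin.Subset.Properties using (∈⊤)
open import Data.Nat using (ℕ)
open import Data.Nat.Divisibility using (_∣_)
open import Data.Product using (_×_; _,_; ∃-syntax)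
open import Data.Sum using (_⊎_)
open import Data.Vec using (tabulate)
open import Relation.Binary.Construct.Closure.ReflexiveTransitive using (Star)
open import Relation.Binary.PropositionalEquality using (_≡_; _≢_)
open import Relation.Nullary using (¬_; does)

-- Edges are separate objects, so parallel edges are allowed.  The order of
-- the two ends of an edge carries no meaning.
record Graph : Set where
  field
    #V #E    : ℕ
    end₁     : Fin #E → Fin #V
    end₂     : Fin #E → Fin #V
    loopless : ∀ e → end₁ e ≢ end₂ e

module _ (G : Graph) where
  open Graph G

  -- Since there are no loops, the degree of v is the number of edges in this set.
  incident : Fin #V → Subset #E
  incident v = tabulate λ e → does (end₁ e ≟ v) ∨ does (end₂ e ≟ v)

  Joins : Fin #E → Fin #V → Fin #V → Set
  Joins e u v = (end₁ e ≡ u × end₂ e ≡ v) ⊎ (end₁ e ≡ v × end₂ e ≡ u)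

  record Subgraph : Set where
    field
      vertices : Subset #V
      edges    : Subset #E
      closed   : ∀ {e} → e ∈ edges → end₁ e ∈ vertices × end₂ e ∈ vertices

  whole : Subgraph
  whole = record { vertices = ⊤ ; edges = ⊤ ; closed = λ _ → ∈⊤ , ∈⊤ }

module _ {G : Graph} where
  open Graph G
  open Subgraph

  degree : Subgraph G → Fin #V → ℕ
  degree H v = ∣ edges H ∩ incident G v ∣

  IsRegularSubgraph : ℕ → Subgraph G → Set
  IsRegularSubgraph k H = ∀ v → v ∈ vertices H → degree H v ≡ k

  IsSpanning : Subgraph G → Set
  IsSpanning H = vertices H ≡ ⊤

  Adjacent : Subgraph G → Fin #V → Fin #V → Set
  Adjacent H u v = ∃[ e ] (e ∈ edges H × Joins G e u v)

  -- By `closed`, a walk starting in H stays in H.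
  IsConnected : Subgraph G → Set
  IsConnected H = Nonempty (vertices H) ×
    (∀ u v → u ∈ vertices H → v ∈ vertices H → Star (Adjacent H) u v)

  IsCycle : Subgraph G → Set
  IsCycle C = IsConnected C × IsRegularSubgraph 2 C

  IsOddCycle : Subgraph G → Set
  IsOddCycle C = IsCycle C × ¬ (2 ∣ ∣ edges C ∣)

  EdgeDisjoint : Subgraph G → Subgraph G → Set
  EdgeDisjoint H K = Empty (edges H ∩ edges K)

IsRegular : ℕ → Graph → Set
IsRegular r G = IsRegularSubgraph r (whole G)

IsFactor : ℕ → (G : Graph) → Subgraph G → Set
IsFactor t G H = IsSpanning H × IsRegularSubgraph t H

{-# OPTIONS --safe #-}
module Submission where

-- Let m = ⌊t/2⌋ + 1 and take m triangles sharing exactly a vertex w.  Make this windmill r-regular by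
-- hanging a three-vertex blob at every vertex; a blob forces a t-factor to have even degree in the
-- windmill at its vertex.  At a vertex of degree 2 this means both or none of the two edges, so a
-- t-factor contains each triangle or misses it.  As 2m > t, it cannot contain all m triangles at w.
-- Conversely some t-factor contains all triangles but one, since 2m ≤ r and t ≤ r − 2.

open import Defs
open import Data.Bool using (Bool; true; false; _∧_; _∨_; if_then_else_)
open import Data.Fin using (Fin; zero; suc; _↑ˡ_; _↑ʳ_; splitAt)
open import Data.Fin.Properties
  using (_≟_; suc-injective; ↑ˡ-injective; ↑ʳ-injective; splitAt-↑ˡ; splitAt-↑ʳ; splitAt⁻¹-↑ˡ; splitAt⁻¹-↑ʳ)
open import Data.Fin.Patterns
open import Data.Fin.Subset using (Subset; _∈_; _∉_; _∩_; _∪_; ⊤; ⊥; ⁅_⁆; ∣_∣)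
open import Data.Fin.Subset.Properties
  using (∈⊤; ∣⊤∣≡n; ∣⊥∣≡0; x∈⁅x⁆; x∈⁅y⁆⇒x≡y; x∈p∩q⁻; x∈p∪q⁻; x∈p∪q⁺; ∩-identityʳ; ∪-identityˡ)
open import Data.List using (List; []; _∷_; map)
open import Data.List.Relation.Unary.All as All using (All; []; _∷_)
import Data.List.Relation.Unary.All.Properties as All
open import Data.List.Relation.Unary.AllPairs as AllPairs using (AllPairs; []; _∷_)
import Data.List.Relation.Unary.AllPairs.Properties as AllPairs
open import Data.List.Relation.Unary.Any as Any using (Any; here; there)
import Data.List.Relation.Unary.Any.Properties as Any
open import Data.Nat using (ℕ; zero; suc; _+_; _*_; _≤_; z≤n; s≤s)
import Data.Nat.Divisibility as Div
open import Data.Nat.Properties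
  using (+-assoc; +-comm; +-suc; +-identityʳ; +-cancelʳ-≡; ≤-refl; ≤-reflexive; ≤-trans; <⇒≱;
         +-mono-≤; +-monoˡ-≤; m≤m+n; m≤n+m; m≤n⇒∃[o]m+o≡n)
open import Data.Nat.Solver using (module +-*-Solver)
open import Data.Product using (Σ; _×_; ∃; ∃-syntax; _,_; proj₁; proj₂)
open import Data.Sum using (_⊎_; inj₁; inj₂)
open import Data.Vec as Vec using (Vec; []; _∷_; _++_; lookup; replicate; tabulate; here; there)
open import Data.Vec.Properties using (lookup-map; lookup-++ˡ; lookup-++ʳ; []=⇒lookup; lookup⇒[]=; lookup∘tabulate)
open import Data.Vec.Relation.Unary.All as Vecᴬ using ([]; _∷_)
import Data.Vec.Relation.Unary.All.Properties as Vecᴬ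
open import Function using (_∘_; Injective; mk⇔)
open import Relation.Binary.Construct.Closure.ReflexiveTransitive using (Star; ε; _◅_; _◅◅_)
open import Relation.Binary.PropositionalEquality
open import Relation.Nullary using (does; contradiction)
open import Relation.Nullary.Decidable using (dec-true; dec-false; does-⇔; toWitnessFalse)

private variable
  a b m n N : ℕ

-- Degrees in edge lists

Edge : ℕ → Set
Edge N = Fin N × Fin N

meets : Edge N → Fin N → Bool
meets (x , y) v = does (x ≟ v) ∨ does (y ≟ v)

bit : Bool → ℕ
bit c = if c then 1 else 0

infixr 7 _⊙_
-- A conditional rather than a product, so that at a concrete vertex, where `meets` computes, each
-- summand of a degree formula reduces to the count itself or to `0`.
_⊙_ : Bool → ℕ → ℕ
c ⊙ k = if c then k else 0

deg : Vec (Edge N) n → Subset n → Fin N → ℕ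
deg []       []      v = 0
deg (e ∷ es) (x ∷ F) v = meets e v ⊙ bit x + deg es F v

∣∷∣ : ∀ x (p : Subset n) → ∣ x ∷ p ∣ ≡ bit x + ∣ p ∣
∣∷∣ true  p = refl
∣∷∣ false p = refl

deg-++ : (es : Vec (Edge N) m) (fs : Vec (Edge N) n) (F : Subset m) (H : Subset n) →
         ∀ v → deg (es ++ fs) (F ++ H) v ≡ deg es F v + deg fs H v
deg-++ []       fs []      H v = refl
deg-++ (e ∷ es) fs (x ∷ F) H v =
  trans (cong (meets e v ⊙ bit x +_) (deg-++ es fs F H v))
        (sym (+-assoc (meets e v ⊙ bit x) (deg es F v) (deg fs H v)))

deg-replicate : ∀ (e : Edge N) (F : Subset n) v → deg (replicate n e) F v ≡ meets e v ⊙ ∣ F ∣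
deg-replicate e F v with meets e v in eq
deg-replicate e []      v | true  = refl
deg-replicate e []      v | false = refl
deg-replicate e (x ∷ F) v | true  rewrite eq | ∣∷∣ x F =
  cong (bit x +_) (trans (deg-replicate e F v) (cong (_⊙ ∣ F ∣) eq))
deg-replicate e (x ∷ F) v | false rewrite eq =
  trans (deg-replicate e F v) (cong (_⊙ ∣ F ∣) eq)

meets-map : ∀ {f : Fin m → Fin n} → Injective _≡_ _≡_ f → ∀ x y v →
            meets (f x , f y) (f v) ≡ meets (x , y) v
meets-map {f = f} inj x y v = cong₂ _∨_ (same x) (same y)
  where
  same : ∀ x → does (f x ≟ f v) ≡ does (x ≟ v)
  same x = does-⇔ (mk⇔ inj (cong f)) (f x ≟ f v) (x ≟ v)

mapEdge : (Fin m → Fin n) → Edge m → Edge n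
mapEdge f (x , y) = f x , f y

deg-map : ∀ {f : Fin m → Fin n} → Injective _≡_ _≡_ f → (es : Vec (Edge m) a) (F : Subset a) →
          ∀ v → deg (Vec.map (mapEdge f) es) F (f v) ≡ deg es F v
deg-map inj []             []      v = refl
deg-map inj ((x , y) ∷ es) (c ∷ F) v =
  cong₂ _+_ (cong (_⊙ bit c) (meets-map inj x y v)) (deg-map inj es F v)

deg-avoid : ∀ {f : Fin m → Fin n} {v} → (∀ x → f x ≢ v) → (es : Vec (Edge m) a) (F : Subset a) →
            deg (Vec.map (mapEdge f) es) F v ≡ 0
deg-avoid av []             []      = refl
deg-avoid {f = f} {v} av ((x , y) ∷ es) (c ∷ F)
  rewrite dec-false (f x ≟ v) (av x) | dec-false (f y ≟ v) (av y) = deg-avoid av es F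

Loopless : Vec (Edge N) n → Set
Loopless = Vecᴬ.All (λ e → proj₁ e ≢ proj₂ e)

fromEdges : (es : Vec (Edge N) n) → Loopless es → Graph
fromEdges {N} {n} es ok = record
  { #V = N ; #E = n
  ; end₁ = λ e → proj₁ (lookup es e) ; end₂ = λ e → proj₂ (lookup es e)
  ; loopless = Vecᴬ.lookup⁺ ok }

-- The bridge to `degree`: for the edge set `F` of a subgraph of `fromEdges es ok`, the left side is
-- its degree at `v` by unfolding. Everything else can then be done with the recursive `deg`.
∣∩incident∣ : (es : Vec (Edge N) n) (F : Subset n) → ∀ v →
              ∣ F ∩ tabulate (λ e → meets (lookup es e) v) ∣ ≡ deg es F v
∣∩incident∣ []       []      v = refl
∣∩incident∣ (e ∷ es) (x ∷ F) v =
  trans (∣∷∣ (x ∧ meets e v) (F ∩ tabulate (λ i → meets (lookup es i) v))) (cong₂ _+_ (bit-∧ x (meets e v)) (∣∩incident∣ es F v))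
  where
  bit-∧ : ∀ x c → bit (x ∧ c) ≡ c ⊙ bit x
  bit-∧ true  true  = refl
  bit-∧ true  false = refl
  bit-∧ false true  = refl
  bit-∧ false false = refl

-- Wedges of rooted graphs

-- Vertex zero is the root of a rooted graph, and the wedge of two rooted graphs identifies their roots.
leftᵛ : Fin (suc a) → Fin (suc (a + b))
leftᵛ {b = b} = _↑ˡ b

rightᵛ : Fin (suc b) → Fin (suc (a + b))
rightᵛ         zero    = zero
rightᵛ {a = a} (suc u) = suc (a ↑ʳ u)

rightᵛ-injective : Injective _≡_ _≡_ (rightᵛ {b = b} {a = a})
rightᵛ-injective         {x = zero}  {y = zero}  eq = refl
rightᵛ-injective {a = a} {x = suc x} {y = suc y} eq =
  cong suc (↑ʳ-injective a x y (suc-injective eq))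

↑ˡ≢↑ʳ : ∀ {i : Fin m} {j : Fin n} → i ↑ˡ n ≢ m ↑ʳ j
↑ˡ≢↑ʳ {m} {n} {i} {j} eq
  with trans (sym (splitAt-↑ˡ m i n)) (trans (cong (splitAt m) eq) (splitAt-↑ʳ m n j))
... | ()

leftᵛ-avoids : ∀ (u : Fin b) x → leftᵛ {a = a} x ≢ suc (a ↑ʳ u)
leftᵛ-avoids u (suc x) eq = ↑ˡ≢↑ʳ (suc-injective eq)

rightᵛ-avoids : ∀ (u : Fin a) x → rightᵛ {b = b} x ≢ suc (u ↑ˡ b)
rightᵛ-avoids u (suc x) eq = ↑ˡ≢↑ʳ (sym (suc-injective eq))

wedge : Vec (Edge (suc a)) m → Vec (Edge (suc b)) n → Vec (Edge (suc (a + b))) (m + n)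
wedge es fs = Vec.map (mapEdge leftᵛ) es ++ Vec.map (mapEdge rightᵛ) fs

module _ (es : Vec (Edge (suc a)) m) (fs : Vec (Edge (suc b)) n) (F : Subset m) (H : Subset n) where

  private
    split : ∀ v → deg (wedge es fs) (F ++ H) v ≡
            deg (Vec.map (mapEdge leftᵛ) es) F v + deg (Vec.map (mapEdge rightᵛ) fs) H v
    split = deg-++ (Vec.map (mapEdge leftᵛ) es) (Vec.map (mapEdge rightᵛ) fs) F H

    leftᵛ-injective : Injective _≡_ _≡_ (leftᵛ {a = a} {b = b})
    leftᵛ-injective = ↑ˡ-injective b _ _

  deg-wedge-root : deg (wedge es fs) (F ++ H) zero ≡ deg es F zero + deg fs H zero
  deg-wedge-root = trans (split zero)
    (cong₂ _+_ (deg-map leftᵛ-injective es F zero) (deg-map rightᵛ-injective fs H zero))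

  deg-wedge-left : ∀ u → deg (wedge es fs) (F ++ H) (suc (u ↑ˡ b)) ≡ deg es F (suc u)
  deg-wedge-left u = trans (split _) (trans
    (cong₂ _+_ (deg-map leftᵛ-injective es F (suc u)) (deg-avoid (rightᵛ-avoids u) fs H))
    (+-identityʳ _))

  deg-wedge-right : ∀ u → deg (wedge es fs) (F ++ H) (suc (a ↑ʳ u)) ≡ deg fs H (suc u)
  deg-wedge-right u = trans (split _)
    (cong₂ _+_ (deg-avoid (leftᵛ-avoids u) es F) (deg-map rightᵛ-injective fs H (suc u)))

wedge-loopless : {es : Vec (Edge (suc a)) m} {fs : Vec (Edge (suc b)) n} →
                 Loopless es → Loopless fs → Loopless (wedge es fs)
wedge-loopless {b = b} p q = Vecᴬ.++⁺
  (Vecᴬ.map⁺ (Vecᴬ.map (λ ne → ne ∘ ↑ˡ-injective b _ _) p))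
  (Vecᴬ.map⁺ (Vecᴬ.map (λ ne → ne ∘ rightᵛ-injective) q))

-- The root has a degree of its own because a wedge adds the degrees at the root and keeps all
-- others. Only the root still changes while pieces are being attached.
record HasDegrees (es : Vec (Edge (suc N)) n) (F : Subset n) (ρ τ : ℕ) : Set where
  constructor degrees
  field
    root : deg es F zero ≡ ρ
    rest : ∀ u → deg es F (suc u) ≡ τ

wedge-degrees : (es : Vec (Edge (suc a)) m) (fs : Vec (Edge (suc b)) n) {F : Subset m} {H : Subset n} →
  ∀ {ρ σ τ} → HasDegrees es F ρ τ → HasDegrees fs H σ τ → HasDegrees (wedge es fs) (F ++ H) (ρ + σ) τ
wedge-degrees {a} {b = b} es fs {F} {H} {τ = τ} (degrees p p′) (degrees q q′) =
  degrees (trans (deg-wedge-root es fs F H) (cong₂ _+_ p q)) rest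
  where
  rest : ∀ u → deg (wedge es fs) (F ++ H) (suc u) ≡ τ
  rest u with splitAt a u in eq
  ... | inj₁ i = subst (λ w → deg (wedge es fs) (F ++ H) (suc w) ≡ τ) (splitAt⁻¹-↑ˡ eq)
                   (trans (deg-wedge-left es fs F H i) (p′ i))
  ... | inj₂ j = subst (λ w → deg (wedge es fs) (F ++ H) (suc w) ≡ τ) (splitAt⁻¹-↑ʳ eq)
                   (trans (deg-wedge-right es fs F H j) (q′ j))

-- Triangles as odd cycles

-- The three edges run head to tail in their stored orientation. Distinctness of the corners is not
-- recorded: any two corners are the ends of one of the edges, so it follows from looplessness.
record Triangle (es : Vec (Edge N) n) : Set where
  field
    edge : Fin 3 → Fin n
    e₁₂  : proj₂ (lookup es (edge 0F)) ≡ proj₁ (lookup es (edge 1F))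
    e₂₃  : proj₂ (lookup es (edge 1F)) ≡ proj₁ (lookup es (edge 2F))
    e₃₁  : proj₂ (lookup es (edge 2F)) ≡ proj₁ (lookup es (edge 0F))
  e₁ e₂ e₃ : Fin n
  e₁ = edge 0F
  e₂ = edge 1F
  e₃ = edge 2F

open Triangle

edgesOf : {es : Vec (Edge N) n} → Triangle es → Subset n
edgesOf T = ⁅ e₁ T ⁆ ∪ (⁅ e₂ T ⁆ ∪ ⁅ e₃ T ⁆)

Misses : {es : Vec (Edge N) n} → Subset n → Triangle es → Set
Misses F T = ∀ i → edge T i ∉ F

∣⁅x⁆∪p∩q∣ : ∀ (x : Fin n) (p q : Subset n) → x ∉ p →
            ∣ (⁅ x ⁆ ∪ p) ∩ q ∣ ≡ bit (lookup q x) + ∣ p ∩ q ∣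
∣⁅x⁆∪p∩q∣ zero (true  ∷ p) (c ∷ q) x∉p = contradiction here x∉p
∣⁅x⁆∪p∩q∣ zero (false ∷ p) (c ∷ q) x∉p
  rewrite ∪-identityˡ p = ∣∷∣ c (p ∩ q)
∣⁅x⁆∪p∩q∣ (suc x) (y ∷ p) (c ∷ q) x∉p = begin
  ∣ (y ∧ c) ∷ ((⁅ x ⁆ ∪ p) ∩ q) ∣             ≡⟨ ∣∷∣ (y ∧ c) ((⁅ x ⁆ ∪ p) ∩ q) ⟩
  bit (y ∧ c) + ∣ (⁅ x ⁆ ∪ p) ∩ q ∣           ≡⟨ cong (bit (y ∧ c) +_) (∣⁅x⁆∪p∩q∣ x p q (x∉p ∘ there)) ⟩
  bit (y ∧ c) + (bit (lookup q x) + ∣ p ∩ q ∣) ≡⟨ solve 3 (λ i j k → i :+ (j :+ k) := j :+ (i :+ k)) refl (bit (y ∧ c)) (bit (lookup q x)) ∣ p ∩ q ∣ ⟩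
  bit (lookup q x) + (bit (y ∧ c) + ∣ p ∩ q ∣) ≡⟨ cong (bit (lookup q x) +_) (∣∷∣ (y ∧ c) (p ∩ q)) ⟨
  bit (lookup q x) + ∣ (y ∷ p) ∩ (c ∷ q) ∣    ∎
  where open ≡-Reasoning; open +-*-Solver

-- The set `q` stays arbitrary so that one formula gives both the degrees of a triangle (`q` the
-- edges at a vertex) and its number of edges (`q = ⊤`).
∣⁅x,y,z⁆∩q∣ : ∀ {x y z : Fin n} → x ≢ y → y ≢ z → z ≢ x → ∀ q →
  ∣ (⁅ x ⁆ ∪ (⁅ y ⁆ ∪ ⁅ z ⁆)) ∩ q ∣ ≡ bit (lookup q x) + (bit (lookup q y) + (bit (lookup q z) + 0))
∣⁅x,y,z⁆∩q∣ {n} {x} {y} {z} x≢y y≢z z≢x q =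
  trans (∣⁅x⁆∪p∩q∣ x (⁅ y ⁆ ∪ ⁅ z ⁆) q x∉) (cong (bit (lookup q x) +_)
  (trans (∣⁅x⁆∪p∩q∣ y ⁅ z ⁆ q (y≢z ∘ x∈⁅y⁆⇒x≡y z)) (cong (bit (lookup q y) +_) (single z q))))
  where
  x∉ : x ∉ ⁅ y ⁆ ∪ ⁅ z ⁆
  x∉ x∈ with x∈p∪q⁻ ⁅ y ⁆ ⁅ z ⁆ x∈
  ... | inj₁ h = x≢y (x∈⁅y⁆⇒x≡y y h)
  ... | inj₂ h = z≢x (sym (x∈⁅y⁆⇒x≡y z h))
  ⊥∩ : ∀ {n} (q : Subset n) → ∣ replicate n false ∩ q ∣ ≡ 0
  ⊥∩ []      = refl
  ⊥∩ (c ∷ q) = ⊥∩ q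
  single : ∀ {n} (z : Fin n) q → ∣ ⁅ z ⁆ ∩ q ∣ ≡ bit (lookup q z) + 0
  single zero    (c ∷ q) = trans (∣∷∣ c (replicate _ false ∩ q)) (cong (bit c +_) (⊥∩ q))
  single (suc z) (c ∷ q) = single z q

∈-triple : ∀ {k} {i j l v : Fin k} (P : Fin k → Set) → P i → P j → P l →
           v ∈ ⁅ i ⁆ ∪ (⁅ j ⁆ ∪ ⁅ l ⁆) → P v
∈-triple {i = i} {j} {l} P pi pj pl v∈ with x∈p∪q⁻ ⁅ i ⁆ _ v∈
... | inj₁ h = subst P (sym (x∈⁅y⁆⇒x≡y i h)) pi
... | inj₂ h with x∈p∪q⁻ ⁅ j ⁆ ⁅ l ⁆ h
...   | inj₁ g = subst P (sym (x∈⁅y⁆⇒x≡y j g)) pj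
...   | inj₂ g = subst P (sym (x∈⁅y⁆⇒x≡y l g)) pl

module _ {es : Vec (Edge N) n} (ok : Loopless es) (T : Triangle es) where

  private
    G : Graph
    G = fromEdges es ok

    open Graph G

    x y z : Fin N
    x = end₁ (e₁ T)
    y = end₁ (e₂ T)
    z = end₁ (e₃ T)

    x≢y : x ≢ y
    x≢y eq = loopless (e₁ T) (trans eq (sym (e₁₂ T)))
    y≢z : y ≢ z
    y≢z eq = loopless (e₂ T) (trans eq (sym (e₂₃ T)))
    z≢x : z ≢ x
    z≢x eq = loopless (e₃ T) (trans eq (sym (e₃₁ T)))

    corners : Subset N
    corners = ⁅ x ⁆ ∪ (⁅ y ⁆ ∪ ⁅ z ⁆)

    x∈ : x ∈ corners
    x∈ = x∈p∪q⁺ (inj₁ (x∈⁅x⁆ x))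
    y∈ : y ∈ corners
    y∈ = x∈p∪q⁺ (inj₂ (x∈p∪q⁺ (inj₁ (x∈⁅x⁆ y))))
    z∈ : z ∈ corners
    z∈ = x∈p∪q⁺ {p = ⁅ x ⁆} (inj₂ (x∈p∪q⁺ {p = ⁅ y ⁆} (inj₂ (x∈⁅x⁆ z))))

  triangle : Subgraph G
  triangle = record
    { vertices = corners
    ; edges    = edgesOf T
    ; closed   = ∈-triple (λ e → end₁ e ∈ corners × end₂ e ∈ corners)
        (x∈ , subst (_∈ corners) (sym (e₁₂ T)) y∈)
        (y∈ , subst (_∈ corners) (sym (e₂₃ T)) z∈)
        (z∈ , subst (_∈ corners) (sym (e₃₁ T)) x∈)
    }

  private
    ∣triangle∩∣ : ∀ q → ∣ edgesOf T ∩ q ∣ ≡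
                  bit (lookup q (e₁ T)) + (bit (lookup q (e₂ T)) + (bit (lookup q (e₃ T)) + 0))
    ∣triangle∩∣ = ∣⁅x,y,z⁆∩q∣
      -- The three edges are distinct because they start at distinct corners.
      (x≢y ∘ cong end₁) (y≢z ∘ cong end₁) (z≢x ∘ cong end₁)

    ∈₁ : e₁ T ∈ edgesOf T
    ∈₁ = x∈p∪q⁺ (inj₁ (x∈⁅x⁆ (e₁ T)))
    ∈₃ : e₃ T ∈ edgesOf T
    ∈₃ = x∈p∪q⁺ {p = ⁅ e₁ T ⁆} (inj₂ (x∈p∪q⁺ {p = ⁅ e₂ T ⁆} (inj₂ (x∈⁅x⁆ (e₃ T)))))


    connected : ∀ u v → u ∈ corners → v ∈ corners → Star (Adjacent triangle) u v
    connected u v u∈ v∈ =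
      -- Every walk is routed through the corner `x`.
      ∈-triple (λ w → Star (Adjacent triangle) w x) ε
        ((e₁ T , ∈₁ , inj₂ (refl , e₁₂ T)) ◅ ε)
        ((e₃ T , ∈₃ , inj₁ (refl , e₃₁ T)) ◅ ε) u∈
      ◅◅
      ∈-triple (λ w → Star (Adjacent triangle) x w) ε
        ((e₁ T , ∈₁ , inj₁ (refl , e₁₂ T)) ◅ ε)
        ((e₃ T , ∈₃ , inj₂ (refl , e₃₁ T)) ◅ ε) v∈

    -- Lets the second end of each edge be replaced by the first end of the next one, so that the
    -- incidence bits mention only `x`, `y` and `z`.
    at : ∀ v e {i j} → end₁ e ≡ i → end₂ e ≡ j → lookup (incident G v) e ≡ meets (i , j) v
    at v e refl refl = lookup∘tabulate (λ e → meets (lookup es e) v) e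

    regular : IsRegularSubgraph 2 triangle
    regular v v∈ = trans (∣triangle∩∣ (incident G v)) (trans
      (cong₂ _+_ (cong bit (at v (e₁ T) refl (e₁₂ T))) (cong₂ _+_ (cong bit (at v (e₂ T) refl (e₂₃ T)))
        (cong (λ c → bit c + 0) (at v (e₃ T) refl (e₃₁ T)))))
      (∈-triple (λ v → bit (meets (x , y) v) + (bit (meets (y , z) v) + (bit (meets (z , x) v) + 0)) ≡ 2)
        at-x at-y at-z v∈))
      where
      at-x : bit (meets (x , y) x) + (bit (meets (y , z) x) + (bit (meets (z , x) x) + 0)) ≡ 2
      at-x rewrite dec-true (x ≟ x) refl | dec-false (y ≟ x) (x≢y ∘ sym) | dec-false (z ≟ x) z≢x = refl
      at-y : bit (meets (x , y) y) + (bit (meets (y , z) y) + (bit (meets (z , x) y) + 0)) ≡ 2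
      at-y rewrite dec-true (y ≟ y) refl | dec-false (x ≟ y) x≢y | dec-false (z ≟ y) (y≢z ∘ sym) = refl
      at-z : bit (meets (x , y) z) + (bit (meets (y , z) z) + (bit (meets (z , x) z) + 0)) ≡ 2
      at-z rewrite dec-true (z ≟ z) refl | dec-false (x ≟ z) (z≢x ∘ sym) | dec-false (y ≟ z) y≢z = refl

    ∣triangle∣ : ∣ edgesOf T ∣ ≡ 3
    ∣triangle∣ = trans (cong ∣_∣ (sym (∩-identityʳ (edgesOf T)))) (trans (∣triangle∩∣ ⊤) ones)
      where
      one : ∀ e → lookup (⊤ {n}) e ≡ true
      one e = []=⇒lookup (∈⊤ {x = e})
      ones : bit (lookup (⊤ {n}) (e₁ T)) + (bit (lookup (⊤ {n}) (e₂ T)) + (bit (lookup (⊤ {n}) (e₃ T)) + 0)) ≡ 3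
      ones rewrite one (e₁ T) | one (e₂ T) | one (e₃ T) = refl

  triangle-odd : IsOddCycle triangle
  triangle-odd = (((x , x∈) , connected) , regular) ,
                 λ d → toWitnessFalse {a? = 2 Div.∣? 3} _ (subst (2 Div.∣_) ∣triangle∣ d)

  misses⇒disjoint : ∀ (K : Subgraph G) → Misses (Subgraph.edges K) T → EdgeDisjoint K triangle
  misses⇒disjoint K h (e , e∈) with x∈p∩q⁻ (Subgraph.edges K) (edgesOf T) e∈
  ... | e∈K , e∈T = ∈-triple (_∉ Subgraph.edges K) (h 0F) (h 1F) (h 2F) e∈T e∈K

Apart : {es : Vec (Edge N) n} → Triangle es → Triangle es → Set
Apart T T′ = ∀ i j → edge T i ≢ edge T′ j

apart⇒disjoint : {es : Vec (Edge N) n} (ok : Loopless es) {T T′ : Triangle es} →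
                 Apart T T′ → EdgeDisjoint (triangle ok T) (triangle ok T′)
apart⇒disjoint ok {T} {T′} apart = misses⇒disjoint ok T′ (triangle ok T)
  λ j e∈ → ∈-triple (_≢ edge T′ j) (apart 0F j) (apart 1F j) (apart 2F j) e∈ refl

-- Triangles inside a wedge

module _ (es : Vec (Edge (suc a)) m) (fs : Vec (Edge (suc b)) n) where

  private
    lookup-left : ∀ e → lookup (wedge es fs) (e ↑ˡ n) ≡ mapEdge leftᵛ (lookup es e)
    lookup-left e = trans (lookup-++ˡ (Vec.map (mapEdge leftᵛ) es) _ e) (lookup-map e (mapEdge leftᵛ) es)

    lookup-right : ∀ e → lookup (wedge es fs) (m ↑ʳ e) ≡ mapEdge rightᵛ (lookup fs e)
    lookup-right e = trans (lookup-++ʳ (Vec.map (mapEdge leftᵛ) es) _ e) (lookup-map e (mapEdge rightᵛ) fs)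

  leftᵗ : Triangle es → Triangle (wedge es fs)
  leftᵗ T = record
    { edge = λ i → edge T i ↑ˡ n
    ; e₁₂ = via (e₁ T) (e₂ T) (e₁₂ T) ; e₂₃ = via (e₂ T) (e₃ T) (e₂₃ T) ; e₃₁ = via (e₃ T) (e₁ T) (e₃₁ T) }
    where
    via : ∀ e e′ → proj₂ (lookup es e) ≡ proj₁ (lookup es e′) →
          proj₂ (lookup (wedge es fs) (e ↑ˡ n)) ≡ proj₁ (lookup (wedge es fs) (e′ ↑ˡ n))
    via e e′ eq rewrite lookup-left e | lookup-left e′ = cong leftᵛ eq

  rightᵗ : Triangle fs → Triangle (wedge es fs)
  rightᵗ T = record
    { edge = λ i → m ↑ʳ edge T i
    ; e₁₂ = via (e₁ T) (e₂ T) (e₁₂ T) ; e₂₃ = via (e₂ T) (e₃ T) (e₂₃ T) ; e₃₁ = via (e₃ T) (e₁ T) (e₃₁ T) }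
    where
    via : ∀ e e′ → proj₂ (lookup fs e) ≡ proj₁ (lookup fs e′) →
          proj₂ (lookup (wedge es fs) (m ↑ʳ e)) ≡ proj₁ (lookup (wedge es fs) (m ↑ʳ e′))
    via e e′ eq rewrite lookup-right e | lookup-right e′ = cong rightᵛ eq

  leftᵗ-misses : ∀ {F : Subset m} {H : Subset n} {T} → Misses F T → Misses (F ++ H) (leftᵗ T)
  leftᵗ-misses {F} {H} {T} miss i e∈ =
    miss i (lookup⇒[]= _ F (trans (sym (lookup-++ˡ F H (edge T i))) ([]=⇒lookup e∈)))

  rightᵗ-misses : ∀ {F : Subset m} {H : Subset n} {T} → Misses H T → Misses (F ++ H) (rightᵗ T)
  rightᵗ-misses {F} {H} {T} miss i e∈ =
    miss i (lookup⇒[]= _ H (trans (sym (lookup-++ʳ F H (edge T i))) ([]=⇒lookup e∈)))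

  leftᵗ-rightᵗ-apart : ∀ T T′ → Apart (leftᵗ T) (rightᵗ T′)
  leftᵗ-rightᵗ-apart T T′ i j = ↑ˡ≢↑ʳ

  rightᵗ-apart : ∀ {T T′} → Apart T T′ → Apart (rightᵗ T) (rightᵗ T′)
  rightᵗ-apart apart i j = apart i j ∘ ↑ʳ-injective m _ _

-- Blobs and pendant triangles

-- If F has degree τ at p, q and s, it has equally many edges p-q and p-s, hence τ − 2κ edges v-p
-- for some κ: at v, the blob leaves an even degree 2κ for the rest of F.
blob : ∀ l μ z (v p q s : Fin N) → Vec (Edge N) (l + (μ + (μ + z)))
blob l μ z v p q s =
  replicate l (v , p) ++ (replicate μ (p , q) ++ (replicate μ (p , s) ++ replicate z (q , s)))

deg-blob : ∀ {l μ z} (v p q s : Fin N) (A : Subset l) (B C : Subset μ) (D : Subset z) u →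
  deg (blob l μ z v p q s) (A ++ (B ++ (C ++ D))) u ≡
  meets (v , p) u ⊙ ∣ A ∣ + (meets (p , q) u ⊙ ∣ B ∣ + (meets (p , s) u ⊙ ∣ C ∣ + meets (q , s) u ⊙ ∣ D ∣))
deg-blob v p q s A B C D u =
  trans (deg-++ (replicate _ (v , p)) _ A _ u) (cong₂ _+_ (deg-replicate _ A u)
  (trans (deg-++ (replicate _ (p , q)) _ B _ u) (cong₂ _+_ (deg-replicate _ B u)
  (trans (deg-++ (replicate _ (p , s)) _ C D u) (cong₂ _+_ (deg-replicate _ C u) (deg-replicate _ D u))))))

base : ∀ l μ z → Vec (Edge 4) (l + (μ + (μ + z)))
base l μ z = blob l μ z 0F 1F 2F 3F

-- The same `B` marks the p-q and the p-s edges, so the conditions at q and s coincide.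
base-degrees : ∀ {l μ z ρ τ} (A : Subset l) (B : Subset μ) (D : Subset z) →
  ∣ A ∣ ≡ ρ → ∣ A ∣ + (∣ B ∣ + ∣ B ∣) ≡ τ → ∣ B ∣ + ∣ D ∣ ≡ τ →
  HasDegrees (base l μ z) (A ++ (B ++ (B ++ D))) ρ τ
base-degrees {τ = τ} A B D eqv eqp eqq = degrees (trans (f 0F) (trans (+-identityʳ _) eqv)) rest
  where
  f = deg-blob 0F 1F 2F 3F A B B D
  rest : ∀ u → _ ≡ τ
  rest 0F = trans (f 1F) (trans (cong (λ h → ∣ A ∣ + (∣ B ∣ + h)) (+-identityʳ _)) eqp)
  rest 1F = trans (f 2F) eqq
  rest 2F = trans (f 3F) eqq

-- Pendant blobs have `μ = 1`: their vertex v has degree 2 in the windmill, so r-regularity gives r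
-- - 2 edges v-p and leaves p with two more, one to q and one to s.
#blob : ℕ → ℕ → ℕ
#blob l z = l + (1 + (1 + z))

-- A triangle on 0, 1, 5 with blobs {2, 3, 4} at 1 and {6, 7, 8} at 5.
pendant : ∀ l z → Vec (Edge 9) (3 + (#blob l z + #blob l z))
pendant l z = (0F , 1F) ∷ (1F , 5F) ∷ (5F , 0F) ∷ (blob l 1 z 1F 2F 3F 4F ++ blob l 1 z 5F 6F 7F 8F)

module _ {l z : ℕ} (i j k : Bool) (A : Subset l) (B C : Subset 1) (D : Subset z)
         (A′ : Subset l) (B′ C′ : Subset 1) (D′ : Subset z) where

  pendantMarks : Subset (3 + (#blob l z + #blob l z))
  pendantMarks = i ∷ j ∷ k ∷ ((A ++ (B ++ (C ++ D))) ++ (A′ ++ (B′ ++ (C′ ++ D′))))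

  deg-pendant : ∀ u → deg (pendant l z) pendantMarks u ≡
    meets (0F , 1F) u ⊙ bit i + (meets (1F , 5F) u ⊙ bit j + (meets (5F , 0F) u ⊙ bit k +
    ((meets (1F , 2F) u ⊙ ∣ A ∣ + (meets (2F , 3F) u ⊙ ∣ B ∣ + (meets (2F , 4F) u ⊙ ∣ C ∣ + meets (3F , 4F) u ⊙ ∣ D ∣))) +
     (meets (5F , 6F) u ⊙ ∣ A′ ∣ + (meets (6F , 7F) u ⊙ ∣ B′ ∣ + (meets (6F , 8F) u ⊙ ∣ C′ ∣ + meets (7F , 8F) u ⊙ ∣ D′ ∣))))))
  deg-pendant u = cong (λ h → meets (0F , 1F) u ⊙ bit i + (meets (1F , 5F) u ⊙ bit j + (meets (5F , 0F) u ⊙ bit k + h)))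
    (trans (deg-++ (blob l 1 z 1F 2F 3F 4F) (blob l 1 z 5F 6F 7F 8F) (A ++ (B ++ (C ++ D))) (A′ ++ (B′ ++ (C′ ++ D′))) u)
           (cong₂ _+_ (deg-blob 1F 2F 3F 4F A B C D u) (deg-blob 5F 6F 7F 8F A′ B′ C′ D′ u)))

-- One Boolean `c` decides the whole triangle and the single p-q and p-s edges. The conditions at v
-- and at p then agree, both being twice `bit c` plus the number of v-p edges.
pendant-degrees : ∀ {l z τ} c (A : Subset l) (D : Subset z) →
  bit c + (bit c + ∣ A ∣) ≡ τ → bit c + ∣ D ∣ ≡ τ →
  HasDegrees (pendant l z) (pendantMarks c c c A (c ∷ []) (c ∷ []) D A (c ∷ []) (c ∷ []) D) (bit c + bit c) τ
pendant-degrees {τ = τ} c A D eqp eqq = degrees (trans (f 0F) (cong (bit c +_) (+-identityʳ _))) rest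
  where
  open +-*-Solver
  f = deg-pendant c c c A (c ∷ []) (c ∷ []) D A (c ∷ []) (c ∷ []) D
  ∣c∣ : ∣ c ∷ [] ∣ ≡ bit c
  ∣c∣ = trans (∣∷∣ c []) (+-identityʳ _)
  corner : bit c + (bit c + ∣ A ∣) ≡ τ → bit c + (bit c + ((∣ A ∣ + 0) + 0)) ≡ τ
  corner = trans (cong (λ h → bit c + (bit c + h)) (trans (+-identityʳ _) (+-identityʳ _)))
  p-row : ∀ {β} → β ≡ bit c → ∣ A ∣ + (β + (β + 0)) ≡ τ
  p-row refl = trans (solve 2 (λ a β → a :+ (β :+ (β :+ con 0)) := β :+ (β :+ a)) refl ∣ A ∣ (bit c)) eqp
  q-row : ∀ {β} → β ≡ bit c → β + ∣ D ∣ ≡ τ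
  q-row refl = eqq
  rest : ∀ u → _ ≡ τ
  rest 0F = trans (f 1F) (corner eqp)
  rest 1F = trans (f 2F) (trans (+-identityʳ _) (p-row ∣c∣))
  rest 2F = trans (f 3F) (trans (+-identityʳ _) (q-row ∣c∣))
  rest 3F = trans (f 4F) (trans (+-identityʳ _) (q-row ∣c∣))
  rest 4F = trans (f 5F) (trans (cong (λ h → bit c + (bit c + h)) (sym (+-identityʳ _))) (corner eqp))
  rest 5F = trans (f 6F) (p-row ∣c∣)
  rest 6F = trans (f 7F) (q-row ∣c∣)
  rest 7F = trans (f 8F) (q-row ∣c∣)

pendantTriangle : ∀ l z → Triangle (pendant l z)
pendantTriangle l z = record { edge = λ i → i ↑ˡ _ ; e₁₂ = refl ; e₂₃ = refl ; e₃₁ = refl }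

-- Here `a`, `β`, `γ`, `d` count the chosen edges v-p, p-q, p-s, q-s, and `i`, `j` the two triangle
-- edges at v. The equations at q and s give `β ≡ γ`; then those at v and p are compared by
-- cancelling `a`.
corner-even : ∀ {τ} i j a β γ d → i + (j + a) ≡ τ → a + (β + γ) ≡ τ → β + d ≡ τ → γ + d ≡ τ →
              i + j ≡ β + β
corner-even {τ} i j a β γ d ev ep eq es
  with refl ← +-cancelʳ-≡ d β γ (trans eq (sym es)) =
  +-cancelʳ-≡ a (i + j) (β + β)
    (trans (+-assoc i j a) (trans ev (trans (sym ep) (+-comm a (β + β)))))

even⇒≡ : ∀ i j {β} → bit i + bit j ≡ β + β → i ≡ j
even⇒≡ true  true          eq = refl
even⇒≡ false false         eq = refl
even⇒≡ true  false {suc β} eq with () ← trans eq (cong suc (+-suc β β))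
even⇒≡ false true  {suc β} eq with () ← trans eq (cong suc (+-suc β β))

-- The blobs at the two non-root corners make consecutive triangle edges agree, so the triangle is
-- chosen entirely or not at all. If chosen, two of its edges lie at the root. Nothing is assumed at
-- the root, where other pieces contribute as well.
pendant-dichotomy : ∀ l z {τ} (F : Subset (3 + (#blob l z + #blob l z))) →
  (∀ u → deg (pendant l z) F (suc u) ≡ τ) →
  Misses F (pendantTriangle l z) ⊎ 2 ≤ deg (pendant l z) F zero
pendant-dichotomy l z {τ} (i ∷ j ∷ k ∷ F) h
  with Vec.splitAt (#blob l z) F
... | X , Y , refl with Vec.splitAt l X | Vec.splitAt l Y
... | A , (b ∷ c ∷ D) , refl | A′ , (b′ ∷ c′ ∷ D′) , refl =
  -- Only the first and third triangle edges meet the root, so `f 0F` has the right side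
  -- `bit i + (bit k + 0)`.
  conclude i j k i≡j j≡k (f 0F)
  where
  B = b ∷ []
  C = c ∷ []
  B′ = b′ ∷ []
  C′ = c′ ∷ []
  f = deg-pendant i j k A B C D A′ B′ C′ D′
  g : ∀ u → _ ≡ τ
  g u = trans (sym (f (suc u))) (h u)
  i≡j : i ≡ j
  i≡j = even⇒≡ i j {∣ B ∣} (corner-even (bit i) (bit j) (∣ A ∣) (∣ B ∣) (∣ C ∣) (∣ D ∣)
    (trans (cong (λ h → bit i + (bit j + h)) (sym (trans (+-identityʳ _) (+-identityʳ _)))) (g 0F))
    (trans (sym (trans (+-identityʳ _) (cong (λ h → ∣ A ∣ + (∣ B ∣ + h)) (+-identityʳ _)))) (g 1F))
    (trans (sym (+-identityʳ _)) (g 2F))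
    (trans (sym (+-identityʳ _)) (g 3F)))
  j≡k : j ≡ k
  j≡k = even⇒≡ j k {∣ B′ ∣} (corner-even (bit j) (bit k) (∣ A′ ∣) (∣ B′ ∣) (∣ C′ ∣) (∣ D′ ∣)
    (trans (cong (λ h → bit j + (bit k + h)) (sym (+-identityʳ _))) (g 4F))
    (trans (sym (cong (λ h → ∣ A′ ∣ + (∣ B′ ∣ + h)) (+-identityʳ _))) (g 5F))
    (g 6F) (g 7F))
  conclude : ∀ i j k {F δ} → i ≡ j → j ≡ k → δ ≡ bit i + (bit k + 0) →
             Misses (i ∷ j ∷ k ∷ F) (pendantTriangle l z) ⊎ 2 ≤ δ
  conclude true  .true  .true  refl refl refl = inj₂ ≤-refl
  conclude false .false .false refl refl eq   = inj₁ λ where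
    0F ()
    1F (there ())
    2F (there (there ()))

blob-loopless : ∀ l μ z {v p q s : Fin N} → v ≢ p → p ≢ q → p ≢ s → q ≢ s → Loopless (blob l μ z v p q s)
blob-loopless l μ z vp pq ps qs =
  Vecᴬ.++⁺ (all l vp) (Vecᴬ.++⁺ (all μ pq) (Vecᴬ.++⁺ (all μ ps) (all z qs)))
  where
  all : ∀ n {e : Edge N} → proj₁ e ≢ proj₂ e → Loopless (replicate n e)
  all zero    ne = []
  all (suc n) ne = ne ∷ all n ne

pendant-loopless : ∀ l z → Loopless (pendant l z)
pendant-loopless l z = (λ ()) ∷ (λ ()) ∷ (λ ()) ∷ Vecᴬ.++⁺
  (blob-loopless l 1 z (λ ()) (λ ()) (λ ()) (λ ())) (blob-loopless l 1 z (λ ()) (λ ()) (λ ()) (λ ()))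

-- The windmill

module Windmill (l z : ℕ) (es : Vec (Edge (suc b)) n) where

  #verts #edges : ℕ → ℕ
  #verts zero    = b
  #verts (suc m) = 8 + #verts m
  #edges zero    = n
  #edges (suc m) = (3 + (#blob l z + #blob l z)) + #edges m

  windmill : ∀ m → Vec (Edge (suc (#verts m))) (#edges m)
  windmill zero    = es
  windmill (suc m) = wedge (pendant l z) (windmill m)

  loopless : Loopless es → ∀ m → Loopless (windmill m)
  loopless ok zero    = ok
  loopless ok (suc m) = wedge-loopless (pendant-loopless l z) (loopless ok m)

  triangles : ∀ m → List (Triangle (windmill m))
  triangles zero    = []
  triangles (suc m) = leftᵗ (pendant l z) (windmill m) (pendantTriangle l z)
                    ∷ map (rightᵗ (pendant l z) (windmill m)) (triangles m)

  triangles-apart : ∀ m → AllPairs Apart (triangles m)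
  triangles-apart zero    = []
  triangles-apart (suc m) =
    All.map⁺ (All.universal (leftᵗ-rightᵗ-apart (pendant l z) (windmill m) (pendantTriangle l z)) (triangles m))
    ∷ AllPairs.map⁺ (AllPairs.map (λ {T} {T′} → rightᵗ-apart (pendant l z) (windmill m) {T} {T′}) (triangles-apart m))

  -- Induction on the number of pendants: the condition away from the root restricts to both sides
  -- of a wedge, and each triangle that is not missed adds 2 to the degree at the root.
  dichotomy : ∀ m {τ} (F : Subset (#edges m)) → (∀ u → deg (windmill m) F (suc u) ≡ τ) →
              Any (Misses F) (triangles m) ⊎ m * 2 ≤ deg (windmill m) F zero
  dichotomy zero    F h = inj₂ z≤n
  dichotomy (suc m) F h with Vec.splitAt (3 + (#blob l z + #blob l z)) F
  ... | P , H , refl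
    with pendant-dichotomy l z P (λ u → trans (sym (deg-wedge-left (pendant l z) (windmill m) P H u)) (h (u ↑ˡ _)))
       | dichotomy m H (λ u → trans (sym (deg-wedge-right (pendant l z) (windmill m) P H u)) (h (8 ↑ʳ u)))
  ... | inj₁ miss | _        = inj₁ (here (leftᵗ-misses (pendant l z) (windmill m) {P} {H} {pendantTriangle l z} miss))
  ... | inj₂ _    | inj₁ any = inj₁ (there (Any.map⁺ (Any.map (λ {T} → rightᵗ-misses (pendant l z) (windmill m) {P} {H} {T}) any)))
  ... | inj₂ p    | inj₂ q   = inj₂ (subst (2 + m * 2 ≤_) (sym (deg-wedge-root (pendant l z) (windmill m) P H)) (+-mono-≤ p q))

  module _ (P : Subset (3 + (#blob l z + #blob l z))) (H : Subset n) where

    spread : ∀ m → Subset (#edges m)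
    spread zero    = H
    spread (suc m) = P ++ spread m

    spread-degrees : ∀ {ρ τ} → HasDegrees (pendant l z) P 2 τ → HasDegrees es H ρ τ →
                     ∀ m → HasDegrees (windmill m) (spread m) (m * 2 + ρ) τ
    spread-degrees p h zero    = h
    spread-degrees p h (suc m) = wedge-degrees (pendant l z) (windmill m) p (spread-degrees p h m)

⊤-++ : ∀ m n → ⊤ {m + n} ≡ ⊤ {m} ++ ⊤ {n}
⊤-++ zero    n = refl
⊤-++ (suc m) n = cong (true ∷_) (⊤-++ m n)

subsetOfSize : m ≤ n → ∃ λ (p : Subset n) → ∣ p ∣ ≡ m
subsetOfSize {n = n} z≤n = ⊥ , ∣⊥∣≡0 n
subsetOfSize (s≤s m≤n) with subsetOfSize m≤n
... | p , eq = true ∷ p , cong suc eq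

-- Multiplicities, regularity and the factor

module Construction (k σ d : ℕ) (σ≤1 : σ ≤ 1) where

  -- `μ` serves both as the number of triangles and as the number of p-q and of p-s edges in the
  -- blob at the root: the root has degree `2μ + l₀` and its neighbour p has `l₀ + 2μ`. The other
  -- values are forced by r-regularity, namely `l = r − 2`, `z = r − 1`, `l₀ = r − 2μ` and
  -- `z₀ = r − μ`, written without subtraction.
  t r μ l z l₀ z₀ : ℕ
  t = σ + (k + k)
  r = 2 + (t + d)
  μ = suc k
  l = t + d
  z = suc (t + d)
  l₀ = σ + d
  z₀ = (k + σ) + suc d

  open Windmill l z (base l₀ μ z₀)
  open +-*-Solver

  -- Makes regularity of the whole graph an instance of `spread-degrees`.
  edges-⊤ : ∀ n → spread ⊤ ⊤ n ≡ ⊤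
  edges-⊤ zero    = refl
  edges-⊤ (suc n) = trans (cong (⊤ {3 + (#blob l z + #blob l z)} ++_) (edges-⊤ n))
                          (sym (⊤-++ (3 + (#blob l z + #blob l z)) (#edges n)))

  pendant-regular : HasDegrees (pendant l z) ⊤ 2 r
  pendant-regular = subst (λ F → HasDegrees (pendant l z) F 2 r) eq
    (pendant-degrees true (⊤ {l}) (⊤ {z}) (cong (2 +_) (∣⊤∣≡n l)) (cong suc (∣⊤∣≡n z)))
    where
    blob-⊤ : ⊤ {l} ++ (⊤ {1} ++ (⊤ {1} ++ ⊤ {z})) ≡ ⊤
    blob-⊤ = sym (⊤-++ l (1 + (1 + z)))
    eq : pendantMarks true true true (⊤ {l}) ⊤ ⊤ (⊤ {z}) ⊤ ⊤ ⊤ ⊤ ≡ ⊤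
    eq = cong (λ F → true ∷ true ∷ true ∷ F)
           (trans (cong₂ _++_ blob-⊤ blob-⊤) (sym (⊤-++ (#blob l z) (#blob l z))))

  base-regular : HasDegrees (base l₀ μ z₀) ⊤ l₀ r
  base-regular = subst (λ F → HasDegrees (base l₀ μ z₀) F l₀ r) eq
    (base-degrees (⊤ {l₀}) (⊤ {μ}) (⊤ {z₀}) (∣⊤∣≡n l₀) p q)
    where
    eq : ⊤ {l₀} ++ (⊤ {μ} ++ (⊤ {μ} ++ ⊤ {z₀})) ≡ ⊤
    eq = sym (trans (⊤-++ l₀ _) (cong (⊤ {l₀} ++_) (trans (⊤-++ μ _) (cong (⊤ {μ} ++_) (⊤-++ μ z₀)))))
    p : ∣ ⊤ {l₀} ∣ + (∣ ⊤ {μ} ∣ + ∣ ⊤ {μ} ∣) ≡ r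
    p rewrite ∣⊤∣≡n l₀ | ∣⊤∣≡n k = solve 3 (λ k σ d →
      (σ :+ d) :+ ((con 1 :+ k) :+ (con 1 :+ k)) := con 2 :+ ((σ :+ (k :+ k)) :+ d)) refl k σ d
    q : ∣ ⊤ {μ} ∣ + ∣ ⊤ {z₀} ∣ ≡ r
    q rewrite ∣⊤∣≡n z₀ | ∣⊤∣≡n k = solve 3 (λ k σ d →
      (con 1 :+ k) :+ ((k :+ σ) :+ (con 1 :+ d)) := con 2 :+ ((σ :+ (k :+ k)) :+ d)) refl k σ d

  windmill-regular : ∀ v → deg (windmill μ) ⊤ v ≡ r
  windmill-regular v with spread-degrees ⊤ ⊤ pendant-regular base-regular μ
  windmill-regular zero    | degrees p _ = trans (sym (cong (λ F → deg (windmill μ) F zero) (edges-⊤ μ)))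
    (trans p (solve 3 (λ k σ d → (con 1 :+ k) :* con 2 :+ (σ :+ d) := con 2 :+ ((σ :+ (k :+ k)) :+ d)) refl k σ d))
  windmill-regular (suc u) | degrees _ q = trans (sym (cong (λ F → deg (windmill μ) F (suc u)) (edges-⊤ μ))) (q u)

  -- Choosing σ edges v-p, k each of p-q and p-s, and k + σ of q-s gives p, q and s degree t. The
  -- root gets only σ; k full triangles will supply the remaining 2k.
  baseFactor : ∃ λ F → HasDegrees (base l₀ μ z₀) F σ t
  baseFactor with subsetOfSize (m≤m+n σ d) | subsetOfSize (m≤n+m k 1) | subsetOfSize (m≤m+n (k + σ) (suc d))
  ... | A , a | B , b | D , e = _ , base-degrees A B D a
    (cong₂ _+_ a (cong₂ _+_ b b))
    (trans (cong₂ _+_ b e) (solve 2 (λ k σ → k :+ (k :+ σ) := σ :+ (k :+ k)) refl k σ))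

  -- With the triangle left out, t edges v-p and t edges q-s suffice. As `z` is `suc l`, the marks
  -- `A` are padded by one unchosen edge.
  unusedPendant : ∃ λ F → HasDegrees (pendant l z) F 0 t
  unusedPendant with subsetOfSize (m≤m+n t d)
  ... | A , a = _ , pendant-degrees false A (false ∷ A) a a

  -- A chosen triangle leaves t - 2 edges v-p at each corner, which needs `k` positive. At q one
  -- edge goes to p, so t - 1 edges q-s are chosen: one more than `A` has.
  usedPendant : ∀ {j} → k ≡ suc j → ∃ λ F → HasDegrees (pendant l z) F 2 t
  usedPendant {j} k≡1+j = _ , pendant-degrees true A (true ∷ A) 2+∣A∣≡t 2+∣A∣≡t
    where
    t-2 = σ + (j + j)
    2+t-2≡t : 2 + t-2 ≡ t
    2+t-2≡t = trans (solve 2 (λ σ j → con 2 :+ (σ :+ (j :+ j)) := σ :+ ((con 1 :+ j) :+ (con 1 :+ j))) refl σ j)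
                    (cong (λ k → σ + (k + k)) (sym k≡1+j))
    chosen : ∃ λ (A : Subset l) → ∣ A ∣ ≡ t-2
    chosen = subsetOfSize (≤-trans (m≤n+m t-2 2) (≤-trans (≤-reflexive 2+t-2≡t) (m≤m+n t d)))
    A = proj₁ chosen
    2+∣A∣≡t : 2 + ∣ A ∣ ≡ t
    2+∣A∣≡t = trans (cong (2 +_) (proj₂ chosen)) 2+t-2≡t

  spokes : ∃ λ F → HasDegrees (windmill k) F (k * 2 + σ) t
  spokes = go k refl
    where
    -- A case split on the fixed parameter `k`: with `k = 0` there is no triangle to choose, and
    -- otherwise `usedPendant` applies.
    go : ∀ j → k ≡ j → ∃ λ F → HasDegrees (windmill j) F (j * 2 + σ) t
    go zero    eq = baseFactor
    go (suc j) eq = _ , spread-degrees _ _ (proj₂ (usedPendant eq)) (proj₂ baseFactor) (suc j)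

  factor : ∃ λ F → ∀ v → deg (windmill μ) F v ≡ t
  factor with unusedPendant | spokes
  -- As `μ = suc k`, the outermost pendant of `windmill μ` is the one whose triangle is left out.
  ... | P , p | H , h with wedge-degrees (pendant l z) (windmill k) p h
  ...   | degrees root rest = P ++ H , λ where
    zero    → trans root (solve 2 (λ k σ → k :* con 2 :+ σ := σ :+ (k :+ k)) refl k σ)
    (suc u) → rest u

  -- If no triangle were missed, the root would have degree at least `2μ = 2k + 2`, which exceeds
  -- `t = σ + 2k` because `σ ≤ 1`.
  some-missed : ∀ F → (∀ v → deg (windmill μ) F v ≡ t) → Any (Misses F) (triangles μ)
  some-missed F h with dichotomy μ F (h ∘ suc)
  ... | inj₁ any = any
  ... | inj₂ big = contradiction (subst (μ * 2 ≤_) (h zero) big) (<⇒≱ t<2μ)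
    where
    t<2μ : suc t ≤ μ * 2
    t<2μ = subst (suc t ≤_) (solve 1 (λ k → con 2 :+ (k :+ k) := (con 1 :+ k) :* con 2) refl k)
             (s≤s (+-monoˡ-≤ (k + k) σ≤1))

-- Assembly

base-loopless : ∀ l μ z → Loopless (base l μ z)
base-loopless l μ z = blob-loopless l μ z (λ ()) (λ ()) (λ ()) (λ ())

halve : ∀ t → ∃[ k ] ∃[ σ ] (σ ≤ 1 × t ≡ σ + (k + k))
halve zero          = 0 , 0 , z≤n , refl
halve (suc zero)    = 0 , 1 , ≤-refl , refl
halve (suc (suc t)) with halve t
... | k , σ , σ≤1 , refl = suc k , σ , σ≤1 , solve 2
  (λ k σ → con 2 :+ (σ :+ (k :+ k)) := σ :+ ((con 1 :+ k) :+ (con 1 :+ k))) refl k σ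
  where open +-*-Solver

theorem2p1 : (r t : ℕ) → 1 ≤ t → t + 2 ≤ r →
    Σ Graph λ G → IsRegular r G × ∃ (IsFactor t G) ×
    Σ (List (Subgraph G)) λ 𝒪 →
    All IsOddCycle 𝒪 × AllPairs EdgeDisjoint 𝒪 ×
    ((F : Subgraph G) → IsFactor t G F → Any (EdgeDisjoint F) 𝒪)
theorem2p1 r t _ t+2≤r with halve t | m≤n⇒∃[o]m+o≡n t+2≤r
-- From here on `t` is `σ + (k + k)` and `r` is `t + 2 + d`, so `d` is the slack in `t + 2 ≤ r`.
... | k , σ , σ≤1 , refl | d , refl =
  G , regular , (F , refl , λ v _ → trans (∣∩incident∣ es (proj₁ factor) v) (proj₂ factor v)) ,
  map (triangle ok) (triangles μ) ,
  All.map⁺ (All.universal (triangle-odd ok) (triangles μ)) ,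
  AllPairs.map⁺ (AllPairs.map (λ {T} {T′} → apart⇒disjoint ok {T} {T′}) (triangles-apart μ)) ,
  λ K (spanning , deg-t) → Any.map⁺ (Any.map (λ {T} → misses⇒disjoint ok T K)
    (some-missed (Subgraph.edges K) λ v →
      -- The degree condition concerns vertices of `K` only; since `K` is spanning, it holds at
      -- every `v`.
      trans (sym (∣∩incident∣ es (Subgraph.edges K) v)) (deg-t v (subst (v ∈_) (sym spanning) ∈⊤))))
  where
  open Construction k σ d σ≤1 hiding (t; r)
  open Windmill l z (base l₀ μ z₀)
  es = windmill μ
  ok : Loopless es
  ok = loopless (base-loopless l₀ μ z₀) μ
  G : Graph
  G = fromEdges es ok
  F : Subgraph G
  F = record { vertices = ⊤ ; edges = proj₁ factor ; closed = λ _ → ∈⊤ , ∈⊤ }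
  regular : IsRegular (σ + (k + k) + 2 + d) G
  regular v _ = trans (∣∩incident∣ es ⊤ v) (trans (windmill-regular v)
    (solve 2 (λ t d → con 2 :+ (t :+ d) := (t :+ con 2) :+ d) refl (σ + (k + k)) d))
    where open +-*-Solver
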